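{- There exists a covering system of the integers such that all moduli are odd, greater than $1$, and pairwise distinct, except that $7$ is used exactly four times as a modulus.
   Context: A covering system of the integers is a finite collection of congruences $x\equiv r_j \pmod{m_j}$ such that every integer satisfies at least one of them. "$7$ is used exactly four times as a modulus" means exactly four congruences of the system have modulus $7$, while all other moduli are distinct from each other and from $7$. -}

module Defs where

open import Data.Nat using (ℕ; _<_)
open import Data.Integer using (ℤ; _-_; +_)
open import Data.Integer.Divisibility using () renaming (_∣_ to _∣ℤ_)
open import Data.Product using (_×_; _,_; proj₁; Σ-syntax)
open import Data.List using (List; map; filter; length)
open import Data.List.Membership.Propositional using (_∈_)
open import Data.List.Relation.Unary.All using (All)
open import Data.List.Relation.Unary.Any using (Any)
open import Data.List.Relation.Unary.Unique.Propositional using (Unique)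
open import Data.Nat using (_≟_)
open import Data.Nat.Divisibility using (_∣_)
open import Relation.Nullary using (¬_)
open import Relation.Nullary.Decidable using (¬?)
open import Relation.Binary.PropositionalEquality using (_≡_)

-- A congruence x ≡ r (mod m) is represented by the pair (m , r).
Congruence : Set
Congruence = ℕ × ℤ

modulus : Congruence → ℕ
modulus = proj₁

Satisfies : ℤ → Congruence → Set
Satisfies x (m , r) = (+ m) ∣ℤ (x - r)

IsCovering : List Congruence → Set
IsCovering cs = (x : ℤ) → Any (Satisfies x) cs

Odd : ℕ → Set
Odd n = ¬ (2 ∣ n)

count7 : List Congruence → ℕ
count7 cs = length (filter (λ c → modulus c ≟ 7) cs)

otherModuli : List Congruence → List ℕ
otherModuli cs = map modulus (filter (λ c → ¬? (modulus c ≟ 7)) cs)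

{-# OPTIONS --safe #-}
-- Run through the primes 3, 5, 7, 11, …, 23, keeping a set of integers that are still uncovered together with
-- t packets: pairwise disjoint sets of moduli, composed of the primes treated so far, each of which (with
-- suitable residues) covers the whole uncovered set; {1} is the first packet. For the next prime
-- p = 1 + t + l consider the lowest nonzero base-p digit δ of x, at position e. If δ ≤ t, cover x by the
-- δ-th packet multiplied by p^(e+1), placed in that digit class. The remaining l digits at each position
-- form the new uncovered set, which any l packets, multiplied by the powers of p and spread over
-- the l digits, cover again; so ⌊t/l⌋ new packets appear.
-- At 7 the four congruences modulo 7 serve four digits at position 0, the packets other than {1} serve two
-- more, digit 0 is refined by the positions above, and there all packets multiplied by 7 are new packets too.
-- The packet numbers are 1, 2, 3, 7, 9, 12, 15, 20, 30, and 30 ≥ 29 packets cover all residues modulo 29.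
-- Only finitely many positions e are used; the multiples of p^31 left out are covered by the 31 moduli
-- 31 p^(j+1), j < 31, one for each residue j modulo 31.

module Submission where

open import Defs
open import Data.Nat using (ℕ; _<_)
open import Data.Product using (Σ-syntax; _×_)
open import Data.List using (List)
open import Data.List.Relation.Unary.All using (All)
open import Data.List.Relation.Unary.Unique.Propositional using (Unique)
open import Relation.Binary.PropositionalEquality using (_≡_)

open import Data.Integer as ℤ using (ℤ; +_; 0ℤ; 1ℤ)
open import Data.Integer.DivMod using (_%ℕ_; _/ℕ_; n%ℕd<d; a≡a%ℕn+[a/ℕn]*n)
open import Data.Integer.Divisibility.Signed as Signed using (divides; ∣ᵤ⇒∣; ∣⇒∣ᵤ; ∣m∣n⇒∣m-n; ∣m∣n⇒∣m+n; ∣n⇒∣m*n)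
import Data.Integer.Properties as ℤₚ
import Data.Integer.Tactic.RingSolver as ℤ-Solver
open import Data.List using ([]; _∷_; _++_; map; length)
open import Data.List.Properties using (map-++; filter-all; filter-none)
open import Data.List.Relation.Unary.All as All using ([]; _∷_)
import Data.List.Relation.Unary.All.Properties as Allₚ
open import Data.List.Relation.Unary.Any using (Any; here; there)
import Data.List.Relation.Unary.Any.Properties as Anyₚ
open import Data.List.Relation.Unary.AllPairs using ([]; _∷_)
import Data.List.Relation.Unary.Unique.Propositional.Properties as Uniqueₚ
open import Data.Nat using (zero; suc; _+_; _*_; _∸_; _^_; _≤_; s≤s; s<s⁻¹; NonZero; _≟_; _<?_; _≤?_)
open import Data.Nat.Coprimality using (Coprime; coprime-divisor; coprime⇒gcd≡1)
import Data.Nat.Divisibility as ℕ∣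
open import Data.Nat.DivMod using (_%_; [m+kn]%n≡m%n; m<n⇒m%n≡m)
open import Data.Nat.Divisibility using (_∣_; _∤_; ∣-trans; ∣1⇒≡1; ∣⇒≤; m∣m*n; _∣?_)
open import Data.Nat.GCD using (gcd; gcd-GCD; module Bézout)
open import Data.Nat.Primality using (Prime; prime?; prime⇒irreducible; prime⇒nonZero; euclidsLemma)
open import Data.Nat.Properties
open import Data.Product using (∃; ∃₂; _,_; proj₁; proj₂; map₁)
open import Data.Sum as Sum using (_⊎_; inj₁; inj₂; [_,_]′)
open import Function using (_∘_; id; case_of_)
open import Level using (0ℓ)
open import Relation.Binary.PropositionalEquality using (_≢_; refl; sym; trans; cong; cong₂; subst; subst₂; module ≡-Reasoning)
open import Relation.Nullary using (¬_; contradiction)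
open import Relation.Nullary.Decidable using (True; False; toWitness; toWitnessFalse; from-yes; from-no; ¬?)
open import Relation.Unary using (Pred; _⊆_; _∪_; _∩_; U; ∅)

-- Divisibility and prime powers.

module _ {p} (p-prime : Prime p) where

  private instance p≢0 = prime⇒nonZero p-prime

  prime≢1 : p ≢ 1
  prime≢1 refl = from-no (prime? 1) p-prime

  prime∣prime : ∀ {q} → Prime q → p ∣ q → p ≡ q
  prime∣prime q-prime p∣q with prime⇒irreducible q-prime p∣q
  ... | inj₁ p≡1 = contradiction p≡1 prime≢1
  ... | inj₂ p≡q = p≡q

  prime∣prime^ : ∀ {q} → Prime q → ∀ e → p ∣ q ^ e → p ≡ q
  prime∣prime^ q-prime zero    p∣1 = contradiction (∣1⇒≡1 p∣1) prime≢1
  prime∣prime^ {q} q-prime (suc e) p∣q^e+1 with euclidsLemma q (q ^ e) p-prime p∣q^e+1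
  ... | inj₁ p∣q   = prime∣prime q-prime p∣q
  ... | inj₂ p∣q^e = prime∣prime^ q-prime e p∣q^e

  prime∣prime^* : ∀ {q} → Prime q → ∀ e {d} → p ∣ q ^ e * d → p ≡ q ⊎ p ∣ d
  prime∣prime^* {q} q-prime e {d} p∣q^ed with euclidsLemma (q ^ e) d p-prime p∣q^ed
  ... | inj₁ p∣q^e = inj₁ (prime∣prime^ q-prime e p∣q^e)
  ... | inj₂ p∣d   = inj₂ p∣d

  prime^-coprime : ∀ e {d} → p ∤ d → Coprime (p ^ e) d
  prime^-coprime zero    p∤d (k∣1 , k∣d) = ∣1⇒≡1 k∣1
  prime^-coprime (suc e) {d} p∤d {k} (k∣p^e+1 , k∣d) =
    prime^-coprime e p∤d (coprime-divisor k⊥p k∣p^e+1 , k∣d)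
    where
    k⊥p : Coprime k p
    k⊥p {l} (l∣k , l∣p) with prime⇒irreducible p-prime l∣p
    ... | inj₁ l≡1 = l≡1
    ... | inj₂ refl = contradiction (∣-trans l∣k k∣d) p∤d

  -- The exponent is the p-adic valuation. This is what keeps moduli built at different digit
  -- positions distinct.
  prime^-*-injective : ∀ e f {c d} → p ∤ c → p ∤ d → p ^ e * c ≡ p ^ f * d → e ≡ f × c ≡ d
  prime^-*-injective zero zero {c} {d} _ _ eq = refl , trans (sym (*-identityˡ c)) (trans eq (*-identityˡ d))
  prime^-*-injective zero (suc f) {c} {d} p∤c _ eq = contradiction
    (subst (p ∣_) (trans (sym eq) (*-identityˡ c)) (∣-trans (m∣m*n (p ^ f)) (m∣m*n d))) p∤c
  prime^-*-injective (suc e) zero {c} {d} _ p∤d eq = contradiction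
    (subst (p ∣_) (trans eq (*-identityˡ d)) (∣-trans (m∣m*n (p ^ e)) (m∣m*n c))) p∤d
  prime^-*-injective (suc e) (suc f) {c} {d} p∤c p∤d eq =
    case prime^-*-injective e f p∤c p∤d
           (*-cancelˡ-≡ _ _ p (trans (sym (*-assoc p (p ^ e) c)) (trans eq (*-assoc p (p ^ f) d)))) of λ where
      (e≡f , c≡d) → cong suc e≡f , c≡d

-- Chinese remaindering.

coprime⇒*-∣ : ∀ {m d n} → Coprime m d → m ∣ n → d ∣ n → m * d ∣ n
coprime⇒*-∣ {m} {d} m⊥d m∣n (ℕ∣.divides q refl)
  with ℕ∣.divides s refl ← coprime-divisor m⊥d (subst (m ∣_) (*-comm q d) m∣n)
  = ℕ∣.divides s (*-assoc s m d)

-- For coprime m and d, the Bézout term that is 0 modulo m and 1 modulo d.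
crtIdempotent : ℕ → ℕ → ℤ
crtIdempotent m d with Bézout.identity (gcd-GCD m d)
... | Bézout.+- x y _ = + (x * m)
... | Bézout.-+ x y _ = ℤ.- + (x * m)

crt : ℕ → ℤ → Congruence → ℤ
crt m c (d , r) = c ℤ.+ (r ℤ.- c) ℤ.* crtIdempotent m d

-- A record rather than a synonym, so that x can be inferred: Satisfies reduces to divisibility of ∣ x - c ∣.
record Class (m : ℕ) (c x : ℤ) : Set where
  constructor class
  field satisfies : Satisfies x (m , c)
  signed : + m Signed.∣ x ℤ.- c
  signed = ∣ᵤ⇒∣ satisfies

module _ {m d} (m⊥d : Coprime m d) where

  crtIdempotent-≡0 : (+ m) Signed.∣ crtIdempotent m d
  crtIdempotent-≡0 with Bézout.identity (gcd-GCD m d)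
  ... | Bézout.+- x y _ = divides (+ x) (ℤₚ.pos-* x m)
  ... | Bézout.-+ x y _ = Signed.∣m⇒∣-m (divides (+ x) (ℤₚ.pos-* x m))

  crtIdempotent-≡1 : (+ d) Signed.∣ (1ℤ ℤ.- crtIdempotent m d)
  crtIdempotent-≡1 with Bézout.identity (gcd-GCD m d)
  ... | Bézout.+- x y eq = divides (ℤ.- + y) (begin
      1ℤ ℤ.- + (x * m)              ≡⟨ cong (λ z → 1ℤ ℤ.- + z) (trans (sym eq) (cong (_+ y * d) gcd≡1)) ⟩
      1ℤ ℤ.- + (1 + y * d)          ≡⟨ cong (λ z → 1ℤ ℤ.- z) (trans (ℤₚ.pos-+ 1 (y * d)) (cong (λ z → 1ℤ ℤ.+ z) (ℤₚ.pos-* y d))) ⟩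
      1ℤ ℤ.- (1ℤ ℤ.+ + y ℤ.* + d)  ≡⟨ ring (+ y) (+ d) ⟩
      ℤ.- + y ℤ.* + d                ∎)
    where
    open ≡-Reasoning
    gcd≡1 : gcd m d ≡ 1
    gcd≡1 = coprime⇒gcd≡1 m⊥d
    ring : ∀ y d → 1ℤ ℤ.- (1ℤ ℤ.+ y ℤ.* d) ≡ ℤ.- y ℤ.* d
    ring = ℤ-Solver.solve-∀
  ... | Bézout.-+ x y eq = divides (+ y) (begin
      1ℤ ℤ.- ℤ.- + (x * m)          ≡⟨ cong (λ z → 1ℤ ℤ.+ z) (ℤₚ.neg-involutive (+ (x * m))) ⟩
      1ℤ ℤ.+ + (x * m)              ≡⟨ sym (ℤₚ.pos-+ 1 (x * m)) ⟩
      + (1 + x * m)                  ≡⟨ cong +_ (trans (cong (_+ x * m) (sym gcd≡1)) eq) ⟩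
      + (y * d)                      ≡⟨ ℤₚ.pos-* y d ⟩
      + y ℤ.* + d                    ∎)
    where
    open ≡-Reasoning
    gcd≡1 : gcd m d ≡ 1
    gcd≡1 = coprime⇒gcd≡1 m⊥d

  -- Modulo m the correction (r - c) e vanishes and leaves c; modulo d the factor e is 1 and turns c
  -- into r.
  crt-class : ∀ {x c r} → Class m c x → Class d r x → Class (m * d) (crt m c (d , r)) x
  crt-class {x} {c} {r} x≡c x≡r = class (coprime⇒*-∣ m⊥d
    (∣⇒∣ᵤ (subst (+ m Signed.∣_) (ring₁ x c r e)
      (∣m∣n⇒∣m-n (Class.signed x≡c) (∣n⇒∣m*n (r ℤ.- c) crtIdempotent-≡0))))
    (∣⇒∣ᵤ (subst (+ d Signed.∣_) (ring₂ x c r e)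
      (∣m∣n⇒∣m+n (Class.signed x≡r) (∣n⇒∣m*n (r ℤ.- c) crtIdempotent-≡1)))))
    where
    e = crtIdempotent m d
    ring₁ : ∀ x c r e → x ℤ.- c ℤ.- (r ℤ.- c) ℤ.* e ≡ x ℤ.- (c ℤ.+ (r ℤ.- c) ℤ.* e)
    ring₁ = ℤ-Solver.solve-∀
    ring₂ : ∀ x c r e → x ℤ.- r ℤ.+ (r ℤ.- c) ℤ.* (1ℤ ℤ.- e) ≡ x ℤ.- (c ℤ.+ (r ℤ.- c) ℤ.* e)
    ring₂ = ℤ-Solver.solve-∀

-- Coverings by distinct moduli from a prescribed set.

Coverable : Pred ℤ 0ℓ → Pred ℕ 0ℓ → Set
Coverable A D = Σ[ cs ∈ List Congruence ]
  ( (∀ {x} → A x → Any (Satisfies x) cs)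
  × All (λ c → D (modulus c)) cs
  × Unique (map modulus cs) )

Scaled : ℕ → Pred ℕ 0ℓ → Pred ℕ 0ℓ
Scaled m D n = ∃ λ d → n ≡ m * d × D d

private variable
  A A′ : Pred ℤ 0ℓ
  D D′ : Pred ℕ 0ℓ

restrict : A′ ⊆ A → D ⊆ D′ → Coverable A D → Coverable A′ D′
restrict A′⊆A D⊆D′ (cs , covers , moduli , unique) = cs , covers ∘ A′⊆A , All.map D⊆D′ moduli , unique

union : (∀ {m} → D m → ¬ D′ m) → Coverable A D → Coverable A′ D′ → Coverable (A ∪ A′) (D ∪ D′)
union {D} {D′} disjoint (cs , covers , moduli , unique) (cs′ , covers′ , moduli′ , unique′) =
    cs ++ cs′
  , [ Anyₚ.++⁺ˡ ∘ covers , Anyₚ.++⁺ʳ cs ∘ covers′ ]′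
  , Allₚ.++⁺ (All.map inj₁ moduli) (All.map inj₂ moduli′)
  , subst Unique (sym (map-++ modulus cs cs′)) (Uniqueₚ.++⁺ unique unique′
      λ (m∈ , m∈′) → disjoint (All.lookup (Allₚ.map⁺ moduli) m∈) (All.lookup (Allₚ.map⁺ moduli′) m∈′))

-- A modulus determines its index, so joining the n lists repeats no modulus.
⋃-coverable : ∀ n {A : ℕ → Pred ℤ 0ℓ} {D : ℕ → Pred ℕ 0ℓ} →
              (∀ {i j m} → D i m → D j m → i ≡ j) → (∀ {i} → i < n → Coverable (A i) (D i)) →
              Coverable (λ x → ∃ λ i → i < n × A i x) (λ m → ∃ λ i → i < n × D i m)
⋃-coverable zero    disjoint cover = [] , (λ ()) , [] , []
⋃-coverable (suc n) {A} disjoint cover =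
  restrict split (λ { (inj₁ (i , i<n , Dim)) → i , m<n⇒m<1+n i<n , Dim ; (inj₂ Dnm) → n , n<1+n n , Dnm })
    (union (λ { (i , i<n , Dim) Dnm → <⇒≢ i<n (disjoint Dim Dnm) })
      (⋃-coverable n disjoint (cover ∘ m<n⇒m<1+n)) (cover (n<1+n n)))
  where
  split : ∀ {x} → (∃ λ i → i < suc n × A i x) → (∃ λ i → i < n × A i x) ⊎ A n x
  split (i , i<1+n , Aix) with m<1+n⇒m<n∨m≡n i<1+n
  ... | inj₁ i<n  = inj₁ (i , i<n , Aix)
  ... | inj₂ refl = inj₂ Aix

-- Each congruence modulo d is combined with c modulo m into one modulo m d. Multiplication by m is
-- injective, so the moduli stay distinct.
scale : ∀ m .{{_ : NonZero m}} c → D ⊆ Coprime m → Coverable A D → Coverable (A ∩ Class m c) (Scaled m D)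
scale {D} {A} m c D⊥m (cs , covers , moduli , unique) =
    map shift cs
  , (λ (Ax , x≡c) → Anyₚ.map⁺ (shifted x≡c moduli (covers Ax)))
  , Allₚ.map⁺ (All.map (λ {c} Dd → modulus c , refl , Dd) moduli)
  , subst Unique (moduli-shift cs) (Uniqueₚ.map⁺ (*-cancelˡ-≡ _ _ m) unique)
  where
  shift : Congruence → Congruence
  shift (d , r) = m * d , crt m c (d , r)
  shifted : ∀ {x cs} → Class m c x → All (λ c → D (modulus c)) cs → Any (Satisfies x) cs → Any (Satisfies x ∘ shift) cs
  shifted x≡c (Dd ∷ _)  (here x≡r)  = here (Class.satisfies (crt-class (D⊥m Dd) x≡c (class x≡r)))
  shifted x≡c (_ ∷ Dds) (there any) = there (shifted x≡c Dds any)
  moduli-shift : ∀ cs → map (m *_) (map modulus cs) ≡ map modulus (map shift cs)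
  moduli-shift []       = refl
  moduli-shift (_ ∷ cs) = cong (_ ∷_) (moduli-shift cs)

-- Packings: disjoint sets of moduli, each covering the same set.

record Packing (H : Pred ℤ 0ℓ) (t : ℕ) (F : Pred ℕ 0ℓ) : Set₁ where
  field
    moduli   : ℕ → Pred ℕ 0ℓ
    disjoint : ∀ {i j m} → moduli i m → moduli j m → i ≡ j
    allowed  : ∀ {i} → moduli i ⊆ F
    covers   : ∀ {i} → i < t → Coverable H (moduli i)

open Packing

private variable
  H H′ : Pred ℤ 0ℓ
  F F′ : Pred ℕ 0ℓ
  t t′ : ℕ

packing-restrict : H′ ⊆ H → F ⊆ F′ → Packing H t F → Packing H′ t F′
packing-restrict H′⊆H F⊆F′ P = record
  { moduli   = moduli P
  ; disjoint = disjoint P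
  ; allowed  = F⊆F′ ∘ allowed P
  ; covers   = restrict H′⊆H id ∘ covers P
  }

everything-coverable : Coverable U (_≡ 1)
everything-coverable = (1 , 0ℤ) ∷ [] , (λ _ → here (ℕ∣.1∣ _)) , refl ∷ [] , [] ∷ []

unit : Packing H 1 (_≡ 1)
unit = record
  { moduli   = λ i m → i ≡ 0 × m ≡ 1
  ; disjoint = λ (i≡0 , _) (j≡0 , _) → trans i≡0 (sym j≡0)
  ; allowed  = proj₂
  ; covers   = λ i<1 → restrict _ (n<1⇒n≡0 i<1 ,_) everything-coverable
  }

append : (∀ {m} → F m → ¬ F′ m) → Packing H t F → Packing H t′ F′ → Packing H (t + t′) (F ∪ F′)
append {F} {F′} {H} {t} {t′} F∩F′=∅ P P′ = record
  { moduli = E ; disjoint = E-disjoint ; allowed = E-allowed ; covers = E-covers }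
  where
  E : ℕ → Pred ℕ 0ℓ
  -- The guards matter: `P` may have nonempty sets at indices from t on, and `i ∸ t` is 0 for every
  -- i below t.
  E i m = (i < t × moduli P i m) ⊎ (t ≤ i × moduli P′ (i ∸ t) m)
  E-disjoint : ∀ {i j m} → E i m → E j m → i ≡ j
  E-disjoint (inj₁ (_ , Di)) (inj₁ (_ , Dj)) = disjoint P Di Dj
  E-disjoint (inj₁ (_ , Di)) (inj₂ (_ , Dj)) = contradiction (allowed P′ Dj) (F∩F′=∅ (allowed P Di))
  E-disjoint (inj₂ (_ , Di)) (inj₁ (_ , Dj)) = contradiction (allowed P′ Di) (F∩F′=∅ (allowed P Dj))
  E-disjoint (inj₂ (t≤i , Di)) (inj₂ (t≤j , Dj)) = ∸-cancelʳ-≡ t≤i t≤j (disjoint P′ Di Dj)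
  E-allowed : ∀ {i} → E i ⊆ F ∪ F′
  E-allowed (inj₁ (_ , Di)) = inj₁ (allowed P Di)
  E-allowed (inj₂ (_ , Di)) = inj₂ (allowed P′ Di)
  E-covers : ∀ {i} → i < t + t′ → Coverable H (E i)
  E-covers {i} i<t+t′ with <-≤-connex i t
  ... | inj₁ i<t = restrict id (λ Di → inj₁ (i<t , Di)) (covers P i<t)
  ... | inj₂ t≤i = restrict id (λ Di → inj₂ (t≤i , Di)) (covers P′
          (+-cancelˡ-< t _ _ (subst (_< t + t′) (sym (m+[n∸m]≡n t≤i)) i<t+t′)))

packing-scale : ∀ m .{{_ : NonZero m}} c → F ⊆ Coprime m → Packing H t F → Packing (H ∩ Class m c) t (Scaled m F)
packing-scale m c F⊥m P = record
  { moduli   = λ i → Scaled m (moduli P i)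
  ; disjoint = λ { {i} {j} (d , refl , Di) (d′ , eq , Dj) →
                 disjoint P Di (subst (moduli P j) (sym (*-cancelˡ-≡ d d′ m eq)) Dj) }
  ; allowed  = λ (d , eq , Di) → d , eq , allowed P Di
  ; covers   = λ i<t → scale m c (F⊥m ∘ allowed P) (covers P i<t)
  }

-- Division with remainder and base-p digits.

quotient-remainder-unique : ∀ {l g g′ h h′} → h < l → h′ < l → g * l + h ≡ g′ * l + h′ → g ≡ g′ × h ≡ h′
quotient-remainder-unique {l@(suc _)} {g} {g′} {h} {h′} h<l h′<l eq = g≡g′ , h≡h′
  where
  remainder : ∀ g {h} → h < l → (g * l + h) % l ≡ h
  remainder g {h} h<l = trans (cong (_% l) (+-comm (g * l) h)) (trans ([m+kn]%n≡m%n h g l) (m<n⇒m%n≡m h<l))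
  h≡h′ : h ≡ h′
  h≡h′ = trans (sym (remainder g h<l)) (trans (cong (_% l) eq) (remainder g′ h′<l))
  g≡g′ : g ≡ g′
  g≡g′ = *-cancelʳ-≡ g g′ l (+-cancelʳ-≡ h (g * l) (g′ * l) (trans eq (cong (λ h → g′ * l + h) (sym h≡h′))))

-- p^e divides x and, when δ < p, the base-p digit of x at position e is δ.
Digit : ℕ → ℕ → ℕ → Pred ℤ 0ℓ
Digit p e δ = Class (p ^ suc e) (+ (δ * p ^ e))

-- Write x = q p^e; the digit is q modulo p.
next-digit : ∀ p .{{_ : NonZero p}} e {x} → Class (p ^ e) 0ℤ x → ∃ λ δ → δ < p × Digit p e δ x
next-digit p e {x} x≡0 with Class.signed x≡0
... | divides q x-0≡qP = q %ℕ p , n%ℕd<d q p , class (∣⇒∣ᵤ (divides (q /ℕ p) (begin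
    x ℤ.- + (δ * P)                                       ≡⟨ cong₂ ℤ._-_ (trans (sym (ℤₚ.+-identityʳ x)) x-0≡qP) (ℤₚ.pos-* δ P) ⟩
    q ℤ.* + P ℤ.- + δ ℤ.* + P                             ≡⟨ cong (λ z → z ℤ.* + P ℤ.- + δ ℤ.* + P) (a≡a%ℕn+[a/ℕn]*n q p) ⟩
    (+ δ ℤ.+ q′ ℤ.* + p) ℤ.* + P ℤ.- + δ ℤ.* + P          ≡⟨ ring (+ δ) q′ (+ p) (+ P) ⟩
    q′ ℤ.* (+ p ℤ.* + P)                                  ≡⟨ cong (λ z → q′ ℤ.* z) (sym (ℤₚ.pos-* p P)) ⟩
    q′ ℤ.* + (p * P)                                      ∎)))
  where
  open ≡-Reasoning
  P = p ^ e
  δ = q %ℕ p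
  q′ = q /ℕ p
  ring : ∀ δ q′ p P → (δ ℤ.+ q′ ℤ.* p) ℤ.* P ℤ.- δ ℤ.* P ≡ q′ ℤ.* (p ℤ.* P)
  ring = ℤ-Solver.solve-∀

first-nonzero-digit : ∀ p .{{_ : NonZero p}} b n {x} → Class (p ^ b) 0ℤ x →
                      (∃₂ λ k δ → k < n × suc δ < p × Digit p (b + k) (suc δ) x) ⊎ Class (p ^ (b + n)) 0ℤ x
first-nonzero-digit p b zero {x} x≡0 = inj₂ (subst (λ e → Class (p ^ e) 0ℤ x) (sym (+-identityʳ b)) x≡0)
first-nonzero-digit p b (suc n) {x} x≡0 with first-nonzero-digit p b n x≡0
... | inj₁ (k , δ , k<n , δ<p , x≡δ) = inj₁ (k , δ , m<n⇒m<1+n k<n , δ<p , x≡δ)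
... | inj₂ x≡0′ with next-digit p (b + n) x≡0′
...   | zero  , _   , x≡δ = inj₂ (subst (λ e → Class (p ^ e) 0ℤ x) (sym (+-suc b n)) x≡δ)
...   | suc δ , δ<p , x≡δ = inj₁ (n , δ , n<1+n n , δ<p , x≡δ)

-- Treating one prime along the digit expansion.

-- Positions b, …, b + n - 1 of the digit expansion; the j-th new packet uses the packets j l, …, j l + l - 1.
module Chain
  {p} (p-prime : Prime p) (b n : ℕ) {t l} (p≡ : p ≡ suc (t + l)) (g : ℕ) (gl≤t : g * l ≤ t)
  {H F} (H⊆ : H ⊆ Class (p ^ b) 0ℤ) (P : Packing H t F) (p∤F : F ⊆ (p ∤_))
  where

  private instance
    p≢0 = prime⇒nonZero p-prime

  Level : ℕ → ℕ → Pred ℤ 0ℓ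
  Level k δ = H ∩ Digit p (b + k) δ

  Covered : Pred ℤ 0ℓ
  Covered x = ∃ λ k → k < n × ∃ λ i → i < t × Level k (suc i) x

  Hole : Pred ℤ 0ℓ
  Hole x = ∃ λ k → k < n × ∃ λ h → h < l × Level k (suc (t + h)) x

  Hole⊆H : Hole ⊆ H
  Hole⊆H (_ , _ , _ , _ , Hx , _) = Hx

  classify : ∀ {x} → H x → Covered x ⊎ Class (p ^ (b + n)) 0ℤ x ⊎ Hole x
  classify Hx with first-nonzero-digit p b n (H⊆ Hx)
  ... | inj₂ x≡0 = inj₂ (inj₁ x≡0)
  -- The digit is `suc δ`: digits 1 to t belong to the packets, the l digits from t + 1 to p - 1 to
  -- the hole.
  ... | inj₁ (k , δ , k<n , δ<p , x≡δ) with <-≤-connex δ t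
  ...   | inj₁ δ<t = inj₁ (k , k<n , δ , δ<t , Hx , x≡δ)
  ...   | inj₂ t≤δ = inj₂ (inj₂ (k , k<n , δ ∸ t ,
          +-cancelˡ-< t _ _ (subst₂ _<_ (sym (m+[n∸m]≡n t≤δ)) refl (s<s⁻¹ (subst (suc δ <_) p≡ δ<p))) ,
          Hx , subst (λ δ → Digit p (b + k) (suc δ) _) (sym (m+[n∸m]≡n t≤δ)) x≡δ))

  Power : Pred ℕ 0ℓ → Pred ℕ 0ℓ
  Power D m = ∃ λ k → k < n × Scaled (p ^ suc (b + k)) D m

  -- The exponent of p in m reveals the position, the cofactor prime to p reveals the packet.
  scaled-injective : ∀ {k k′ i i′ m} → Scaled (p ^ suc (b + k)) (moduli P i) m →
                     Scaled (p ^ suc (b + k′)) (moduli P i′) m → k ≡ k′ × i ≡ i′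
  scaled-injective {k} {k′} (d , refl , Di) (d′ , eq , Di′)
    with prime^-*-injective p-prime (suc (b + k)) (suc (b + k′)) (p∤F (allowed P Di)) (p∤F (allowed P Di′)) eq
  ... | e≡e′ , refl = +-cancelˡ-≡ b k k′ (suc-injective e≡e′) , disjoint P Di Di′

  level-coverable : ∀ k δ {i} → i < t → Coverable (Level k δ) (Scaled (p ^ suc (b + k)) (moduli P i))
  level-coverable k δ i<t = scale (p ^ suc (b + k)) {{m^n≢0 p (suc (b + k))}} _
    (λ Dd → prime^-coprime p-prime (suc (b + k)) (p∤F (allowed P Dd))) (covers P i<t)

  covered-coverable : Coverable Covered (Power F)
  covered-coverable = restrict id
    (λ (k , k<n , i , _ , d , eq , Dd) → k , k<n , d , eq , allowed P Dd)
    (⋃-coverable n (λ (_ , _ , D) (_ , _ , D′) → proj₁ (scaled-injective D D′)) λ {k} _ →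
     ⋃-coverable t (λ D D′ → proj₂ (scaled-injective {k} {k} D D′)) λ {i} i<t →
     level-coverable k (suc i) i<t)

  -- These sets may share moduli with `covered-coverable`. That is harmless, because a packet enters
  -- the system only after multiplication by a later prime.
  holes : Packing Hole g (Power F)
  holes = record
    { moduli   = λ j m → ∃ λ k → k < n × ∃ λ h → h < l × Scaled (p ^ suc (b + k)) (moduli P (j * l + h)) m
    -- A common modulus fixes the old packet index j l + h, and its quotient by l is j.
    ; disjoint = λ (_ , _ , _ , h<l , D) (_ , _ , _ , h′<l , D′) →
                 proj₁ (quotient-remainder-unique h<l h′<l (proj₂ (scaled-injective D D′)))
    ; allowed  = λ (k , k<n , _ , _ , d , eq , Dd) → k , k<n , d , eq , allowed P Dd
    ; covers   = λ {j} j<g →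
        ⋃-coverable n (λ (_ , _ , D) (_ , _ , D′) → proj₁ (scaled-injective D D′)) λ {k} _ →
        ⋃-coverable l (λ D D′ → +-cancelˡ-≡ (j * l) _ _ (proj₂ (scaled-injective {k} {k} D D′))) λ {h} h<l →
        level-coverable k (suc (t + h)) (index<t j<g h<l)
    }
    where
    index<t : ∀ {j h} → j < g → h < l → j * l + h < t
    index<t {j} {h} j<g h<l = begin-strict
      j * l + h  <⟨ +-monoʳ-< (j * l) h<l ⟩
      j * l + l  ≡⟨ +-comm (j * l) l ⟩
      suc j * l  ≤⟨ *-monoˡ-≤ l j<g ⟩
      g * l      ≤⟨ gl≤t ⟩
      t          ∎
      where open ≤-Reasoning

-- Admissible moduli and the reserved prime 31.

abstract
  prime2 : Prime 2
  prime2 = from-yes (prime? 2)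

  prime7 : Prime 7
  prime7 = from-yes (prime? 7)

  prime31 : Prime 31
  prime31 = from-yes (prime? 31)

-- For B ≥ 2: m is odd and all its prime factors are at most B (in Good, at most B or equal to 31).
Free : ℕ → Pred ℕ 0ℓ
Free B m = ∀ {q} → Prime q → q ≡ 2 ⊎ B < q → q ∤ m

Good : ℕ → Pred ℕ 0ℓ
Good B m = 1 < m × m ≢ 7 × (∀ {q} → Prime q → q ≡ 2 ⊎ (B < q × q ≢ 31) → q ∤ m)

-- The nested `Scaled` mirrors two applications of `scale`. The prime 31 lies above all primes
-- treated, which separates these moduli from multiples of packets.
Tail : ℕ → Pred ℕ 0ℓ
Tail p m = ∃ λ j → j < 31 × Scaled 31 (Scaled (p ^ suc j) (_≡ 1)) m

sevens : List Congruence
sevens = (7 , + 1) ∷ (7 , + 2) ∷ (7 , + 3) ∷ (7 , + 4) ∷ []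

1-free : ∀ {B} → Free B 1
1-free q-prime _ q∣1 = prime≢1 q-prime (∣1⇒≡1 q∣1)

free-mono : ∀ {B p} → B < p → Free B ⊆ Free p
free-mono B<p free q-prime = free q-prime ∘ Sum.map₂ (<-trans B<p)

good-mono : ∀ {B p} → B < p → Good B ⊆ Good p
good-mono B<p (1<m , m≢7 , avoids) =
  1<m , m≢7 , λ q-prime → avoids q-prime ∘ Sum.map₂ (map₁ (<-trans B<p))

free-nonZero : ∀ {B m} → Free B m → NonZero m
free-nonZero {m = zero}  free = contradiction (2 ℕ∣.∣0) (free prime2 (inj₁ refl))
free-nonZero {m = suc _} _    = _

p∣p^1+e*d : ∀ p e d → p ∣ p ^ suc e * d
p∣p^1+e*d p e d = ∣-trans (m∣m*n (p ^ e)) (m∣m*n d)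

module _ {p} (p-prime : Prime p) where

  private instance p≢0 = prime⇒nonZero p-prime

  good-multiple : ∀ {m} → 2 < p → NonZero m → p ∣ m → m ≢ 7 →
                  (∀ {q} → Prime q → q ≡ 2 ⊎ (p < q × q ≢ 31) → q ∤ m) → Good p m
  good-multiple 2<p m≢0 p∣m m≢7 avoids =
    <-trans (n<1+n 1) (<-≤-trans 2<p (∣⇒≤ {{m≢0}} p∣m)) , m≢7 , avoids

  multiple≢7 : ∀ {m} → p ≢ 7 → p ∣ m → m ≢ 7
  multiple≢7 p≢7 p∣m refl = p≢7 (prime∣prime p-prime prime7 p∣m)

  free-power : ∀ {B} → 2 < p → B < p → ∀ e {d} → Free B d → Free p (p ^ e * d)
  free-power 2<p B<p e free q-prime q≡2⊎p<q q∣p^ed with prime∣prime^* q-prime p-prime e q∣p^ed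
  ... | inj₂ q∣d = free-mono B<p free q-prime q≡2⊎p<q q∣d
  ... | inj₁ refl with q≡2⊎p<q
  ...   | inj₁ refl = <-irrefl refl 2<p
  ...   | inj₂ p<p  = <-irrefl refl p<p

  free⇒good : ∀ {m} → 2 < p → p ∣ m → m ≢ 7 → Free p m → Good p m
  free⇒good 2<p p∣m m≢7 free = good-multiple 2<p (free-nonZero free) p∣m m≢7
    λ q-prime → free q-prime ∘ Sum.map₂ proj₁

  p∣tail : ∀ {m} → Tail p m → p ∣ m
  p∣tail (j , _ , _ , refl , _ , refl , _) = ℕ∣.∣n⇒∣m*n 31 (p∣p^1+e*d p j _)

  tail-good : 2 < p → Tail p ⊆ Good p
  tail-good 2<p tail@(j , _ , _ , refl , _ , refl , refl) =
    good-multiple 2<p (m*n≢0 31 _ {{_}} {{m*n≢0 (p ^ suc j) 1 {{m^n≢0 p (suc j)}}}}) (p∣tail tail)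
      (λ eq → from-no (31 ∣? 7) (subst (31 ∣_) eq (m∣m*n (p ^ suc j * 1)))) avoids
    where
    avoids : ∀ {q} → Prime q → q ≡ 2 ⊎ (p < q × q ≢ 31) → q ∤ 31 * (p ^ suc j * 1)
    avoids q-prime q≡2⊎p<q q∣m with euclidsLemma 31 _ q-prime q∣m
    avoids q-prime (inj₁ refl) q∣m       | inj₁ q∣31 = from-no (2 ∣? 31) q∣31
    avoids q-prime (inj₂ (_ , q≢31)) q∣m | inj₁ q∣31 = q≢31 (prime∣prime q-prime prime31 q∣31)
    ... | inj₂ q∣p^e = free-power {2} 2<p 2<p (suc j) 1-free q-prime (Sum.map₂ proj₁ q≡2⊎p<q) q∣p^e

  -- The residue j of x modulo 31 selects the modulus 31 p^(j+1); since j < 31, the power p^(j+1)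
  -- divides p^31 and hence x.
  tail-coverable : p ≢ 31 → Coverable (Class (p ^ 31) 0ℤ) (Tail p)
  tail-coverable p≢31 = restrict split id
    (⋃-coverable 31 {D = λ j → Scaled 31 (Scaled (p ^ suc j) (_≡ 1))}
      (λ { {i} {j} (_ , refl , _ , refl , refl) (_ , eq , _ , refl , refl) →
        suc-injective (proj₁ (prime^-*-injective p-prime (suc i) (suc j) p∤1 p∤1 (*-cancelˡ-≡ _ _ 31 eq))) })
      λ {j} _ →
      -- The residue is j 31^0, the form in which `next-digit` returns a digit at position 0.
      scale 31 (+ (j * 1)) (λ { (_ , refl , refl) → prime^-coprime prime31 1 (31∤ j) })
        (scale (p ^ suc j) {{m^n≢0 p (suc j)}} 0ℤ (λ { refl → prime^-coprime p-prime (suc j) p∤1 })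
          everything-coverable))
    where
    p∤1 : p ∤ 1
    p∤1 p∣1 = prime≢1 p-prime (∣1⇒≡1 p∣1)
    31∤ : ∀ j → 31 ∤ p ^ suc j * 1
    31∤ j 31∣p^j with prime∣prime^* prime31 p-prime (suc j) 31∣p^j
    ... | inj₁ 31≡p = p≢31 (sym 31≡p)
    ... | inj₂ 31∣1 = prime≢1 prime31 (∣1⇒≡1 31∣1)
    split : ∀ {x} → Class (p ^ 31) 0ℤ x →
            ∃ λ j → j < 31 × (U x × Class (p ^ suc j) 0ℤ x) × Class 31 (+ (j * 1)) x
    split {x} x≡0 with next-digit 31 0 {x} (class (ℕ∣.1∣ _))
    ... | j , j<31 , x≡j = j , j<31 , (_ , class (∣-trans p^j∣p^31 (Class.satisfies x≡0))) , x≡j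
      where
      p^j∣p^31 : p ^ suc j ∣ p ^ 31
      p^j∣p^31 = subst (p ^ suc j ∣_) (trans (sym (^-distribˡ-+-* p (suc j) (31 ∸ suc j))) (cong (p ^_) (m+[n∸m]≡n j<31))) (m∣m*n _)

-- The induction over the primes.

-- t does not count the packet {1}, whose separation keeps the modulus 7 · 1 from being reused.
record State (B t : ℕ) : Set₁ where
  field
    Covered    : Pred ℤ 0ℓ
    Uncovered  : Pred ℤ 0ℓ
    exhaustive : ∀ x → Any (Satisfies x) sevens ⊎ Covered x ⊎ Uncovered x
    coverable  : Coverable Covered (Good B)
    proper     : Packing Uncovered t (λ m → m ≢ 1 × Free B m)

  packing : Packing Uncovered (suc t) (Free B)
  packing = packing-restrict id [ (λ { refl → 1-free }) , proj₂ ]′ (append (λ m≡1 (m≢1 , _) → m≢1 m≡1) unit proper)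

start : State 2 0
start = record
  { Covered    = ∅
  ; Uncovered  = U
  ; exhaustive = λ _ → inj₂ (inj₂ _)
  ; coverable  = [] , (λ ()) , [] , []
  ; proper     = record { moduli = λ _ → ∅ ; disjoint = λ () ; allowed = λ () ; covers = λ () }
  }

module Step
  {B t} (s : State B t) {p} (p-prime : Prime p) (B<p : B < p) (2<p : 2 < p) (p<31 : p < 31)
  where

  open State s

  private
    instance
      p≢0 : NonZero p
      p≢0 = prime⇒nonZero p-prime

    p^1≢0 : NonZero (p ^ 1)
    p^1≢0 = m^n≢0 p 1

  -- So every multiple of the new prime differs from all moduli spent before; p < 31 keeps p apart
  -- from the prime that `Good` exempts.
  fresh : ∀ {m} → Good B m → p ∤ m
  fresh (_ , _ , avoids) = avoids p-prime (inj₂ (B<p , <⇒≢ p<31))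

  free : ∀ {m} → Free B m → p ∤ m
  free f = f p-prime (inj₂ B<p)

  p⊥free : Free B ⊆ Coprime (p ^ 1)
  p⊥free f = prime^-coprime p-prime 1 (free f)

  p∣scaled : Scaled (p ^ 1) (Free B) ⊆ (p ∣_)
  p∣scaled (d , refl , _) = p∣p^1+e*d p 0 d

  scaled-free : Scaled (p ^ 1) (Free B) ⊆ Free p
  scaled-free (_ , refl , f) = free-power p-prime 2<p B<p 1 f

  p∣⇒≢1 : ∀ {m} → p ∣ m → m ≢ 1
  p∣⇒≢1 p∣1 refl = prime≢1 p-prime (∣1⇒≡1 p∣1)

  tail : Coverable (Class (p ^ 31) 0ℤ) (Tail p)
  tail = tail-coverable p-prime (<⇒≢ p<31)

  -- The factor 31 tells them apart: p and all prime factors of d are below 31.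
  tail-fresh : ∀ {m} e {d} → m ≡ p ^ e * d → Free B d → ¬ Tail p m
  tail-fresh {m} e {d} m≡ f tail =
    [ (λ 31≡p → <-irrefl (sym 31≡p) p<31) , f prime31 (inj₂ (<-trans B<p p<31)) ]′
      (prime∣prime^* prime31 p-prime e {d} (subst (31 ∣_) m≡ (31∣tail tail)))
    where
    31∣tail : Tail p m → 31 ∣ m
    31∣tail (_ , _ , c , m≡31c , _) = ℕ∣.divides c (trans m≡31c (*-comm 31 c))

  -- The old packets still cover the smaller uncovered set, and the g new ones consist of multiples
  -- of p, so the two families add up.
  step : ∀ {l} g → p ≢ 7 → p ≡ suc (suc t + l) → g * l ≤ suc t → State p (t + g)
  step g p≢7 p≡ gl≤t = record
    { Covered    = Covered ∪ (C.Covered ∪ Class (p ^ 31) 0ℤ)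
    ; Uncovered  = C.Hole
    ; exhaustive = exhaustive′
    ; coverable  = restrict id [ good-mono B<p , [ power-good , tail-good p-prime 2<p ]′ ]′
        (union (λ good → fresh good ∘ [ p∣power , p∣tail p-prime ]′) coverable
          (union (λ (k , _ , _ , eq , f) → tail-fresh (suc k) eq f) C.covered-coverable tail))
    ; proper     = packing-restrict id
        [ (λ (m≢1 , f) → m≢1 , free-mono B<p f) , (λ power → p∣⇒≢1 (p∣power power) , power-free power) ]′
        (append (λ (_ , f) → free f ∘ p∣power) (packing-restrict C.Hole⊆H id proper) C.holes)
    }
    where
    -- Positions 0 to 30 leave exactly the multiples of p^31, which `tail` covers.
    module C = Chain p-prime 0 31 p≡ g gl≤t (λ _ → class (ℕ∣.1∣ _)) packing free
    p∣power : C.Power (Free B) ⊆ (p ∣_)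
    p∣power (k , _ , d , refl , _) = p∣p^1+e*d p k d
    power-free : C.Power (Free B) ⊆ Free p
    power-free (k , _ , _ , refl , f) = free-power p-prime 2<p B<p (suc k) f
    power-good : C.Power (Free B) ⊆ Good p
    power-good power = free⇒good p-prime 2<p (p∣power power) (multiple≢7 p-prime p≢7 (p∣power power)) (power-free power)
    exhaustive′ : ∀ x → Any (Satisfies x) sevens ⊎ (Covered ∪ (C.Covered ∪ Class (p ^ 31) 0ℤ)) x ⊎ C.Hole x
    exhaustive′ x with exhaustive x
    ... | inj₁ seven       = inj₁ seven
    ... | inj₂ (inj₁ covd) = inj₂ (inj₁ (inj₁ covd))
    ... | inj₂ (inj₂ Hx) with C.classify Hx
    ...   | inj₁ covd        = inj₂ (inj₁ (inj₂ (inj₁ covd)))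
    ...   | inj₂ (inj₁ x≡0)  = inj₂ (inj₁ (inj₂ (inj₂ x≡0)))
    ...   | inj₂ (inj₂ hole) = inj₂ (inj₂ hole)

  -- At position 0 the nonzero digits below o go to `sevens` and the t digits from o on to the
  -- proper packets; digit 0 is refined. The new total consists of the t old packets, all `suc t`
  -- packets times p on the class of 0, and g packets from the chain. The last two families differ
  -- in the exponent of p, which is 1 or at least 2.
  step7 : ∀ {l} g o → p ≡ 7 → p ≡ o + t → p ≡ suc (suc t + l) → g * l ≤ suc t →
          (∀ {δ x} → suc δ < o → Digit p 0 (suc δ) x → Any (Satisfies x) sevens) → State p (t + (suc t + g))
  step7 {l} g o p≡7 p≡o+t p≡ gl≤t sevens-cover = record
    { Covered    = Covered ∪ (FirstLevel ∪ (C.Covered ∪ Class (p ^ 31) 0ℤ))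
    ; Uncovered  = C.Hole
    ; exhaustive = exhaustive′
    ; coverable  = restrict id
        [ good-mono B<p , [ first-good , [ power-good , tail-good p-prime 2<p ]′ ]′ ]′
        (union (λ good → fresh good ∘ [ p∣scaled ∘ first-scaled , [ p∣power , p∣tail p-prime ]′ ]′) coverable
          (union (λ first → [ scaled≢power (first-scaled first) , first≢tail first ]′) first-coverable
            (union (λ (k , _ , _ , eq , f) → tail-fresh (suc (1 + k)) eq f) C.covered-coverable tail)))
    ; proper     = packing-restrict id
        [ (λ (m≢1 , f) → m≢1 , free-mono B<p f)
        , [ (λ scaled → p∣⇒≢1 (p∣scaled scaled) , scaled-free scaled)
          , (λ power → p∣⇒≢1 (p∣power power) , power-free power) ]′ ]′
        (append (λ (_ , f) → [ free f ∘ p∣scaled , free f ∘ p∣power ]′)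
          (packing-restrict (proj₁ ∘ C.Hole⊆H) id proper)
          (append scaled≢power
            -- This includes the packet {7}. It does not repeat the modulus 7, since only its
            -- multiples by later primes are ever used.
            (packing-restrict C.Hole⊆H id (packing-scale (p ^ 1) {{p^1≢0}} 0ℤ p⊥free packing))
            C.holes))
    }
    where
    -- Position 0 is already spent; positions 1 to 30 again leave the multiples of p^31.
    module C = Chain p-prime 1 30 p≡ g gl≤t {Uncovered ∩ Class (p ^ 1) 0ℤ} proj₂
      (packing-restrict proj₁ id packing) free

    FirstLevel : Pred ℤ 0ℓ
    FirstLevel x = ∃ λ i → i < t × Uncovered x × Digit p 0 (o + i) x
    First : Pred ℕ 0ℓ
    First m = ∃ λ i → i < t × Scaled (p ^ 1) (moduli proper i) m

    first-coverable : Coverable FirstLevel First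
    first-coverable = ⋃-coverable t
      (disjoint (packing-scale (p ^ 1) {{p^1≢0}} 0ℤ (p⊥free ∘ proj₂) proper))
      λ {i} i<t → scale (p ^ 1) {{p^1≢0}} _ (p⊥free ∘ proj₂ ∘ allowed proper) (covers proper i<t)

    p∣power : C.Power (Free B) ⊆ (p ∣_)
    p∣power (k , _ , d , refl , _) = p∣p^1+e*d p (suc k) d
    power-free : C.Power (Free B) ⊆ Free p
    power-free (k , _ , _ , refl , f) = free-power p-prime 2<p B<p (suc (suc k)) f
    first-scaled : First ⊆ Scaled (p ^ 1) (Free B)
    first-scaled (_ , _ , d , eq , Dd) = d , eq , proj₂ (allowed proper Dd)
    scaled≢power : ∀ {m} → Scaled (p ^ 1) (Free B) m → ¬ C.Power (Free B) m
    scaled≢power (d , refl , f) (k , _ , d′ , eq , f′) =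
      case proj₁ (prime^-*-injective p-prime 1 (suc (suc k)) (free f) (free f′) eq) of λ ()
    first≢tail : ∀ {m} → First m → ¬ Tail p m
    first≢tail first = case first-scaled first of λ (_ , eq , f) → tail-fresh 1 eq f
    -- Excludes the modulus 7: the cofactor would be 1, but proper packets do not contain 1, and
    -- higher positions leave another factor p.
    p^1+e*d≡7 : ∀ e {d} → p ^ suc e * d ≡ 7 → p ^ e * d ≡ 1
    p^1+e*d≡7 e {d} eq = *-cancelˡ-≡ _ 1 p
      (trans (sym (*-assoc p (p ^ e) d)) (trans eq (trans (sym p≡7) (sym (*-identityʳ p)))))
    first-good : First ⊆ Good p
    first-good first@(_ , _ , d , refl , Dd) = free⇒good p-prime 2<p (p∣scaled (first-scaled first))
      (λ eq → proj₁ (allowed proper Dd) (trans (sym (*-identityˡ d)) (p^1+e*d≡7 0 eq)))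
      (scaled-free (first-scaled first))
    power-good : C.Power (Free B) ⊆ Good p
    power-good power@(k , _ , d , refl , _) = free⇒good p-prime 2<p (p∣power power)
      (λ eq → p∣⇒≢1 (p∣p^1+e*d p k d) (p^1+e*d≡7 (suc k) eq)) (power-free power)

    exhaustive′ : ∀ x → Any (Satisfies x) sevens ⊎ (Covered ∪ (FirstLevel ∪ (C.Covered ∪ Class (p ^ 31) 0ℤ))) x ⊎ C.Hole x
    exhaustive′ x with exhaustive x
    ... | inj₁ seven       = inj₁ seven
    ... | inj₂ (inj₁ covd) = inj₂ (inj₁ (inj₁ covd))
    ... | inj₂ (inj₂ Hx) with next-digit p 0 {x} (class (ℕ∣.1∣ _))
    ...   | zero , _ , x≡0 with C.classify (Hx , x≡0)
    ...     | inj₁ covd        = inj₂ (inj₁ (inj₂ (inj₂ (inj₁ covd))))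
    ...     | inj₂ (inj₁ x≡0′) = inj₂ (inj₁ (inj₂ (inj₂ (inj₂ x≡0′))))
    ...     | inj₂ (inj₂ hole) = inj₂ (inj₂ hole)
    exhaustive′ x | inj₂ (inj₂ Hx) | suc δ , δ<p , x≡δ with <-≤-connex (suc δ) o
    ...     | inj₁ δ<o = inj₁ (sevens-cover δ<o x≡δ)
    ...     | inj₂ o≤δ = inj₂ (inj₁ (inj₂ (inj₁ (suc δ ∸ o ,
              +-cancelˡ-< o _ _ (subst₂ _<_ (sym (m+[n∸m]≡n o≤δ)) p≡o+t δ<p) ,
              Hx , subst (λ δ → Digit p 0 δ x) (sym (m+[n∸m]≡n o≤δ)) x≡δ))))


  -- With at least p packets, {1} included, every digit at position 0, also the digit 0, receives
  -- its own packet and nothing stays uncovered.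
  complete : p ≢ 7 → p ≤ suc t →
             ∃ λ A → (∀ x → Any (Satisfies x) sevens ⊎ A x) × Coverable A (Good p)
  complete p≢7 p≤1+t = Covered ∪ Last , exhaustive′ ,
    restrict id [ good-mono B<p , scaled-good ∘ last-scaled ]′
      (union (λ good → fresh good ∘ p∣scaled ∘ last-scaled) coverable last-coverable)
    where

    Last : Pred ℤ 0ℓ
    Last x = ∃ λ i → i < p × Uncovered x × Digit p 0 i x
    LastModuli : Pred ℕ 0ℓ
    LastModuli m = ∃ λ i → i < p × Scaled (p ^ 1) (moduli packing i) m
    last-coverable : Coverable Last LastModuli
    last-coverable = ⋃-coverable p
      (disjoint (packing-scale (p ^ 1) {{p^1≢0}} 0ℤ p⊥free packing))
      λ {i} i<p → scale (p ^ 1) {{p^1≢0}} _ (p⊥free ∘ allowed packing) (covers packing (<-≤-trans i<p p≤1+t))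

    last-scaled : LastModuli ⊆ Scaled (p ^ 1) (Free B)
    last-scaled (_ , _ , d , eq , Dd) = d , eq , allowed packing Dd
    scaled-good : Scaled (p ^ 1) (Free B) ⊆ Good p
    scaled-good scaled = free⇒good p-prime 2<p (p∣scaled scaled)
      (multiple≢7 p-prime p≢7 (p∣scaled scaled)) (scaled-free scaled)

    exhaustive′ : ∀ x → Any (Satisfies x) sevens ⊎ (Covered ∪ Last) x
    exhaustive′ x with exhaustive x
    ... | inj₁ seven       = inj₁ seven
    ... | inj₂ (inj₁ covd) = inj₂ (inj₁ covd)
    ... | inj₂ (inj₂ Hx) with next-digit p 0 {x} (class (ℕ∣.1∣ _))
    ...   | i , i<p , x≡i = inj₂ (inj₂ (i , i<p , Hx , x≡i))

-- The concrete run through the primes 3 to 29.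

sevens-cover : ∀ {δ x} → suc δ < 5 → Digit 7 0 (suc δ) x → Any (Satisfies x) sevens
sevens-cover {0} _ (class x≡1) = here x≡1
sevens-cover {1} _ (class x≡2) = there (here x≡2)
sevens-cover {2} _ (class x≡3) = there (there (here x≡3))
sevens-cover {3} _ (class x≡4) = there (there (there (here x≡4)))
sevens-cover {suc (suc (suc (suc _)))} (s≤s (s≤s (s≤s (s≤s (s≤s ()))))) _

next : ∀ {B t l} p g → {True (prime? p)} → {True (B <? p)} → {True (2 <? p)} → {True (p <? 31)} →
       {False (p ≟ 7)} → p ≡ suc (suc t + l) → {True (g * l ≤? suc t)} → State B t → State p (t + g)
next p g {pr} {B<p} {2<p} {p<31} {p≢7} p≡ {gl≤t} s =
  Step.step s (toWitness pr) (toWitness B<p) (toWitness 2<p) (toWitness p<31) g (toWitnessFalse p≢7) p≡ (toWitness gl≤t)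

-- In all these steps g is the number of packets, {1} included, divided by l and rounded down. Here
-- 3 = 1 + 1 + 1 and 5 = 1 + 2 + 2.
state5 : State 5 2
state5 = next {l = 2} 5 1 refl (next {l = 1} 3 1 refl start)

-- With three packets 7 = 1 + 3 + 3 at the positions above 0, and 7 = 5 + 2 at position 0. The
-- proper packets number 2 + 3 + 1 = 6.
state7 : State 7 6
state7 = Step.step7 state5 prime7 (from-yes (5 <? 7)) (from-yes (2 <? 7)) (from-yes (7 <? 31))
  {l = 3} 1 5 refl refl refl ≤-refl sevens-cover

state13 : State 13 11
state13 = next {l = 3} 13 3 refl (next {l = 3} 11 2 refl state7)

state23 : State 23 29
state23 = next {l = 2} 23 10 refl (next {l = 3} 19 5 refl (next {l = 4} 17 3 refl state13))

conclude : ∀ {B} → (∃ λ A → (∀ x → Any (Satisfies x) sevens ⊎ A x) × Coverable A (Good B)) →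
           Σ[ cs ∈ List Congruence ]
             ( IsCovering cs
             × All (λ c → Odd (modulus c) × 1 < modulus c) cs
             × count7 cs ≡ 4
             × Unique (otherModuli cs) )
conclude (A , exhaustive , cs , covers , good , unique) =
    sevens ++ cs
  , (λ x → [ Anyₚ.++⁺ˡ , Anyₚ.++⁺ʳ sevens ∘ covers ]′ (exhaustive x))
  , seven ∷ seven ∷ seven ∷ seven ∷ All.map (λ (1<m , _ , avoids) → avoids prime2 (inj₁ refl) , 1<m) good
  -- The filter evaluates on the four explicit congruences, and `Good` rules out 7 in the rest.
  , cong (λ cs → 4 + length cs) (filter-none (λ c → modulus c ≟ 7) (All.map (proj₁ ∘ proj₂) good))
  , subst (Unique ∘ map modulus) (sym (filter-all (λ c → ¬? (modulus c ≟ 7)) (All.map (proj₁ ∘ proj₂) good))) unique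
  where
  seven : Odd 7 × 1 < 7
  seven = from-no (2 ∣? 7) , from-yes (1 <? 7)

theorem4p1 : Σ[ cs ∈ List Congruence ]
    ( IsCovering cs
    × All (λ c → Odd (modulus c) × 1 < modulus c) cs
    × count7 cs ≡ 4
    × Unique (otherModuli cs) )
theorem4p1 = conclude (Step.complete state23 (from-yes (prime? 29))
  (from-yes (23 <? 29)) (from-yes (2 <? 29)) (from-yes (29 <? 31)) (λ ()) (from-yes (29 ≤? 30)))
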